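{- Let $\xi,\zeta$ be stoups, $\Pi,\Gamma_1,\Gamma_2$ finite sequences of tree terms, $A,C$ formulae and $\Xi(\cdot)$ a meta-formula context. If the sequents $\xi;\Pi\to A$ and $\Xi(\zeta;\Gamma_1,A,\Gamma_2)\to C$ are derivable in the calculus $\mathcal{M}'_{2015}$ defined below, then the sequent $\Xi(\xi,\zeta;\Gamma_1,\Pi,\Gamma_2)\to C$ is also derivable in $\mathcal{M}'_{2015}$.
   Context: Formulae are built from a countable set of variables and the constant $\mathbf{1}$ by the binary connectives $\backslash$, $/$, $\cdot$, $\wedge$, $\vee$ and the unary connectives $\langle\rangle$, $[]^{ -1}$ (bracket modalities) and $!$ (subexponential). A stoup is a finite multiset of formulae ($\varnothing$ is the empty stoup). A tree term is either a formula or an expression $[\Xi]$ with $\Xi$ a meta-formula; a meta-formula is an expression $\zeta;\Gamma$ where $\zeta$ is a stoup and $\Gamma$ is a finite linearly ordered sequence of tree terms (the empty sequence is written $\Lambda$); $\varnothing;\Gamma$ is written simply $\Gamma$. Comma denotes both concatenation of sequences and multiset union of stoups; $\zeta,A$ is $\zeta$ with one more copy of $A$. A sequent is $\Xi\to C$ with $\Xi$ a meta-formula and $C$ a formula. $\Xi(\Theta)$ denotes a meta-formula with a designated occurrence of a meta-formula $\Theta$, which is either $\Xi$ itself or the content of some bracket $[\Theta]$ occurring at any depth in $\Xi$; $\Xi(\Theta')$ is the result of replacing that occurrence by $\Theta'$. Below $A,B,C,D,A_1,A_2$ are formulae, $\Gamma,\Delta,\Delta_i,\Gamma_i$ sequences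 of tree terms, $\zeta,\zeta',\zeta_i$ stoups, $\Xi$ a meta-formula. Common axioms and rules: axioms $A\to A$ and $\Lambda\to\mathbf 1$; ($/L$) from $\zeta_1;\Gamma\to B$ and $\Xi(\zeta_2;\Delta_1,C,\Delta_2)\to D$ infer $\Xi(\zeta_1,\zeta_2;\Delta_1,C/B,\Gamma,\Delta_2)\to D$; ($/R$) from $\zeta;\Gamma,B\to C$ infer $\zeta;\Gamma\to C/B$; ($\backslash L$) from $\zeta_1;\Gamma\to A$ and $\Xi(\zeta_2;\Delta_1,C,\Delta_2)\to D$ infer $\Xi(\zeta_1,\zeta_2;\Delta_1,\Gamma,A\backslash C,\Delta_2)\to D$; ($\backslash R$) from $\zeta;A,\Gamma\to C$ infer $\zeta;\Gamma\to A\backslash C$; ($\cdot L$) from $\Xi(\zeta;\Delta_1,A,B,\Delta_2)\to D$ infer $\Xi(\zeta;\Delta_1,A\cdot B,\Delta_2)\to D$; ($\cdot R$) from $\zeta_1;\Delta\to A$ and $\zeta_2;\Gamma\to B$ infer $\zeta_1,\zeta_2;\Delta,\Gamma\to A\cdot B$; ($\mathbf1 L$) from $\Xi(\zeta;\Delta_1,\Delta_2)\to A$ infer $\Xi(\zeta;\Delta_1,\mathbf1,\Delta_2)\to A$; ($\vee L$) from $\Xi(\zeta;\Delta_1,A_1,\Delta_2)\to C$ and $\Xi(\zeta;\Delta_1,A_2,\Delta_2)\to C$ infer $\Xi(\zeta;\Delta_1,A_1\vee A_2,\Delta_2)\to C$; ($\vee R_i$, $i=1,2$) from $\Xi\to A_i$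 infer $\Xi\to A_1\vee A_2$; ($\wedge L_i$) from $\Xi(\zeta;\Delta_1,A_i,\Delta_2)\to C$ infer $\Xi(\zeta;\Delta_1,A_1\wedge A_2,\Delta_2)\to C$; ($\wedge R$) from $\Xi\to A_1$ and $\Xi\to A_2$ infer $\Xi\to A_1\wedge A_2$; ($[]^{ -1}L$) from $\Xi(\zeta;\Delta_1,A,\Delta_2)\to B$ infer $\Xi(\zeta;\Delta_1,[[]^{ -1}A],\Delta_2)\to B$; ($[]^{ -1}R$) from $[\Xi]\to A$ infer $\Xi\to []^{ -1}A$; ($\langle\rangle L$) from $\Xi(\zeta;\Delta_1,[A],\Delta_2)\to B$ infer $\Xi(\zeta;\Delta_1,\langle\rangle A,\Delta_2)\to B$; ($\langle\rangle R$) from $\Xi\to A$ infer $[\Xi]\to\langle\rangle A$; ($!L$) from $\Xi(\zeta,A;\Gamma_1,\Gamma_2)\to B$ infer $\Xi(\zeta;\Gamma_1,!A,\Gamma_2)\to B$; ($!P$) from $\Xi(\zeta;\Gamma_1,A,\Gamma_2)\to B$ infer $\Xi(\zeta,A;\Gamma_1,\Gamma_2)\to B$. The calculus $\mathcal{M}'_{2015}$ consists of the common axioms and rules together with ($!R'$) from $\zeta;\Lambda\to B$ infer $\zeta;\Lambda\to !B$, provided $\zeta\neq\varnothing$, and ($!C'$) from $\Xi(\zeta_1,\zeta_2;\Gamma_1,[\zeta',\zeta_2;\Gamma_2],\Gamma_3)\to C$ infer $\Xi(\zeta_1,\zeta_2,\zeta';\Gamma_1,\Gamma_2,\Gamma_3)\to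 C$, provided $\zeta_2\neq\varnothing$. Cut is not a rule of the calculus; "derivable" means derivable by the listed axioms and rules. -}

module Defs where

open import Data.Nat using (ℕ)
open import Data.List using (List; []; _∷_; _++_; [_])
open import Data.List.Relation.Binary.Permutation.Propositional using (_↭_)
open import Data.List.Relation.Binary.Pointwise using (Pointwise)
open import Relation.Binary.PropositionalEquality using (_≢_)

infixl 7 _/_
infixr 7 _⧵_
infixl 8 _·_
infixr 6 _∧_
infixr 6 _∨_
infix  9 ⟨⟩_ []⁻¹_ !_

data Formula : Set where
  var               : ℕ → Formula
  𝟏                 : Formula
  _⧵_ _/_ _·_       : Formula → Formula → Formula
  _∧_ _∨_           : Formula → Formula → Formula
  ⟨⟩_ []⁻¹_ !_      : Formula → Formula

-- Stoups are multisets: lists of formulae, identified up to permutation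
-- by the relation _≈_ below and the rule `resp` of the calculus.
Stoup : Set
Stoup = List Formula

infix 4 _⨾_

mutual
  data TreeTerm : Set where
    fm  : Formula → TreeTerm
    ⟦_⟧ : Meta → TreeTerm

  data Meta : Set where
    _⨾_ : Stoup → List TreeTerm → Meta

-- Equality of meta-formulae: stoups, at every bracket depth, are compared
-- as multisets; everything else is compared syntactically.
infix 4 _≈ₜ_
infix 3 _≈_

mutual
  data _≈ₜ_ : TreeTerm → TreeTerm → Set where
    fm  : ∀ A → fm A ≈ₜ fm A
    ⟦_⟧ : ∀ {Θ Θ′} → Θ ≈ Θ′ → ⟦ Θ ⟧ ≈ₜ ⟦ Θ′ ⟧

  data _≈_ : Meta → Meta → Set where
    _⨾_ : ∀ {ζ ζ′ Γ Γ′} → ζ ↭ ζ′ → Pointwise _≈ₜ_ Γ Γ′ → (ζ ⨾ Γ) ≈ (ζ′ ⨾ Γ′)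

-- The hole of a context is either the whole meta-formula or the content of
-- a bracket; `inside ζ Γ Ξ Δ` is  ζ ; Γ , [ Ξ ( · ) ] , Δ.
data Context : Set where
  hole   : Context
  inside : Stoup → List TreeTerm → Context → List TreeTerm → Context

infix 5 _⟪_⟫

_⟪_⟫ : Context → Meta → Meta
hole             ⟪ Θ ⟫ = Θ
inside ζ Γ Ξ Δ   ⟪ Θ ⟫ = ζ ⨾ Γ ++ ⟦ Ξ ⟪ Θ ⟫ ⟧ ∷ Δ

private variable
  A A₁ A₂ B C D      : Formula
  ζ ζ′ ζ₁ ζ₂         : Stoup
  Γ Γ₁ Γ₂ Γ₃ Δ Δ₁ Δ₂ : List TreeTerm
  Θ Θ′               : Meta

infix 3 _⊢_

-- Ξ ⊢ C : the sequent Ξ → C is derivable in M′₂₀₁₅.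
data _⊢_ : Meta → Formula → Set where
  -- Not a logical rule: sequents are considered modulo multiset equality
  -- of stoups.
  resp : Θ ≈ Θ′ → Θ ⊢ C → Θ′ ⊢ C

  ax   : [] ⨾ [ fm A ] ⊢ A
  𝟏R   : [] ⨾ [] ⊢ 𝟏

  /L   : ∀ Ξ → ζ₁ ⨾ Γ ⊢ B → Ξ ⟪ ζ₂ ⨾ Δ₁ ++ fm C ∷ Δ₂ ⟫ ⊢ D →
         Ξ ⟪ ζ₁ ++ ζ₂ ⨾ Δ₁ ++ fm (C / B) ∷ Γ ++ Δ₂ ⟫ ⊢ D
  /R   : ζ ⨾ Γ ++ [ fm B ] ⊢ C →
         ζ ⨾ Γ ⊢ C / B

  ⧵L   : ∀ Ξ → ζ₁ ⨾ Γ ⊢ A → Ξ ⟪ ζ₂ ⨾ Δ₁ ++ fm C ∷ Δ₂ ⟫ ⊢ D →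
         Ξ ⟪ ζ₁ ++ ζ₂ ⨾ Δ₁ ++ Γ ++ fm (A ⧵ C) ∷ Δ₂ ⟫ ⊢ D
  ⧵R   : ζ ⨾ fm A ∷ Γ ⊢ C →
         ζ ⨾ Γ ⊢ A ⧵ C

  ·L   : ∀ Ξ → Ξ ⟪ ζ ⨾ Δ₁ ++ fm A ∷ fm B ∷ Δ₂ ⟫ ⊢ D →
         Ξ ⟪ ζ ⨾ Δ₁ ++ fm (A · B) ∷ Δ₂ ⟫ ⊢ D
  ·R   : ζ₁ ⨾ Δ ⊢ A → ζ₂ ⨾ Γ ⊢ B →
         ζ₁ ++ ζ₂ ⨾ Δ ++ Γ ⊢ A · B

  𝟏L   : ∀ Ξ → Ξ ⟪ ζ ⨾ Δ₁ ++ Δ₂ ⟫ ⊢ A →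
         Ξ ⟪ ζ ⨾ Δ₁ ++ fm 𝟏 ∷ Δ₂ ⟫ ⊢ A

  ∨L   : ∀ Ξ → Ξ ⟪ ζ ⨾ Δ₁ ++ fm A₁ ∷ Δ₂ ⟫ ⊢ C → Ξ ⟪ ζ ⨾ Δ₁ ++ fm A₂ ∷ Δ₂ ⟫ ⊢ C →
         Ξ ⟪ ζ ⨾ Δ₁ ++ fm (A₁ ∨ A₂) ∷ Δ₂ ⟫ ⊢ C
  ∨R₁  : Θ ⊢ A₁ → Θ ⊢ A₁ ∨ A₂
  ∨R₂  : Θ ⊢ A₂ → Θ ⊢ A₁ ∨ A₂

  ∧L₁  : ∀ Ξ → Ξ ⟪ ζ ⨾ Δ₁ ++ fm A₁ ∷ Δ₂ ⟫ ⊢ C →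
         Ξ ⟪ ζ ⨾ Δ₁ ++ fm (A₁ ∧ A₂) ∷ Δ₂ ⟫ ⊢ C
  ∧L₂  : ∀ Ξ → Ξ ⟪ ζ ⨾ Δ₁ ++ fm A₂ ∷ Δ₂ ⟫ ⊢ C →
         Ξ ⟪ ζ ⨾ Δ₁ ++ fm (A₁ ∧ A₂) ∷ Δ₂ ⟫ ⊢ C
  ∧R   : Θ ⊢ A₁ → Θ ⊢ A₂ → Θ ⊢ A₁ ∧ A₂

  []⁻¹L : ∀ Ξ → Ξ ⟪ ζ ⨾ Δ₁ ++ fm A ∷ Δ₂ ⟫ ⊢ B →
          Ξ ⟪ ζ ⨾ Δ₁ ++ ⟦ [] ⨾ [ fm ([]⁻¹ A) ] ⟧ ∷ Δ₂ ⟫ ⊢ B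
  []⁻¹R : [] ⨾ [ ⟦ Θ ⟧ ] ⊢ A →
          Θ ⊢ []⁻¹ A

  ⟨⟩L  : ∀ Ξ → Ξ ⟪ ζ ⨾ Δ₁ ++ ⟦ [] ⨾ [ fm A ] ⟧ ∷ Δ₂ ⟫ ⊢ B →
         Ξ ⟪ ζ ⨾ Δ₁ ++ fm (⟨⟩ A) ∷ Δ₂ ⟫ ⊢ B
  ⟨⟩R  : Θ ⊢ A →
         [] ⨾ [ ⟦ Θ ⟧ ] ⊢ ⟨⟩ A

  !L   : ∀ Ξ → Ξ ⟪ ζ ++ [ A ] ⨾ Γ₁ ++ Γ₂ ⟫ ⊢ B →
         Ξ ⟪ ζ ⨾ Γ₁ ++ fm (! A) ∷ Γ₂ ⟫ ⊢ B
  !P   : ∀ Ξ → Ξ ⟪ ζ ⨾ Γ₁ ++ fm A ∷ Γ₂ ⟫ ⊢ B →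
         Ξ ⟪ ζ ++ [ A ] ⨾ Γ₁ ++ Γ₂ ⟫ ⊢ B

  !R′  : ζ ≢ [] → ζ ⨾ [] ⊢ B →
         ζ ⨾ [] ⊢ ! B
  !C′  : ∀ Ξ → ζ₂ ≢ [] →
         Ξ ⟪ ζ₁ ++ ζ₂ ⨾ Γ₁ ++ ⟦ ζ′ ++ ζ₂ ⨾ Γ₂ ⟧ ∷ Γ₃ ⟫ ⊢ C →
         Ξ ⟪ ζ₁ ++ ζ₂ ++ ζ′ ⨾ Γ₁ ++ Γ₂ ++ Γ₃ ⟫ ⊢ C

{-# OPTIONS --safe #-}

-- A phase-style (Okada) argument. Each formula A is interpreted by a set 𝓥 A of
-- meta-formulae, closed under everything that cut-free left rules can do, in such
-- a way that  fm A ∈ 𝓥 A ⊆ { Θ ∣ Θ ⊢ A }.  Every rule is sound when all formula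
-- occurrences B are replaced by elements of 𝓥 B, where an occurrence in a stoup is
-- replaced by a non-empty stoup (non-emptiness keeps the provisos of !R′ and !C′).
-- Soundness of ξ ⨾ Π ⊢ A gives ξ ⨾ Π ∈ 𝓥 A, so it may replace A in the second
-- premise of the cut.
module Submission where

open import Data.List using (List; []; _∷_; _++_; [_])
open import Data.List.Properties using (++-assoc; ++-identityʳ; ++-conicalˡ)
open import Data.List.Relation.Binary.Permutation.Propositional
  using (_↭_; refl; prep; swap; trans; ↭-refl; ↭-sym; ↭-trans; ↭-reflexive)
open import Data.List.Relation.Binary.Permutation.Propositional.Properties
  using (++-comm; ++⁺; ++⁺ˡ; ++⁺ʳ; ++-commutativeMonoid)
open import Data.List.Relation.Binary.Pointwise as Pointwise using (Pointwise; []; _∷_)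
open import Data.Product using (∃₂; ∃-syntax; _×_; _,_)
open import Data.Sum using (_⊎_; inj₁; inj₂)
open import Function using (_∘_)
open import Relation.Binary.PropositionalEquality as ≡ using (_≡_; _≢_)
open import Defs
open import Algebra.Solver.CommutativeMonoid (++-commutativeMonoid {A = Formula})
  using (solve; _⊕_; _⊜_)

private variable
  A B C D        : Formula
  ζ ζ′ ξ ξ′      : Stoup
  Γ Γ′ Δ Π       : List TreeTerm
  T              : TreeTerm
  Θ Θ′ x x′ y y′ : Meta
  f g            : Meta → Meta

-- Multiset equality of meta-formulae.

mutual
  ≈ₜ-refl : T ≈ₜ T
  ≈ₜ-refl {fm A}  = fm A
  ≈ₜ-refl {⟦ Θ ⟧} = ⟦ ≈-refl ⟧

  ≈*-refl : Pointwise _≈ₜ_ Γ Γ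
  ≈*-refl {[]}    = []
  ≈*-refl {T ∷ Γ} = ≈ₜ-refl ∷ ≈*-refl

  ≈-refl : Θ ≈ Θ
  ≈-refl {ζ ⨾ Γ} = ↭-refl ⨾ ≈*-refl

mutual
  ≈ₜ-sym : ∀ {T T′} → T ≈ₜ T′ → T′ ≈ₜ T
  ≈ₜ-sym (fm A)  = fm A
  ≈ₜ-sym ⟦ p ⟧   = ⟦ ≈-sym p ⟧

  ≈*-sym : Pointwise _≈ₜ_ Γ Γ′ → Pointwise _≈ₜ_ Γ′ Γ
  ≈*-sym []       = []
  ≈*-sym (p ∷ ps) = ≈ₜ-sym p ∷ ≈*-sym ps

  ≈-sym : Θ ≈ Θ′ → Θ′ ≈ Θ
  ≈-sym (p ⨾ q) = ↭-sym p ⨾ ≈*-sym q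

mutual
  ≈ₜ-trans : ∀ {T T′ T″} → T ≈ₜ T′ → T′ ≈ₜ T″ → T ≈ₜ T″
  ≈ₜ-trans (fm A) q       = q
  ≈ₜ-trans ⟦ p ⟧  ⟦ q ⟧   = ⟦ ≈-trans p q ⟧

  ≈*-trans : ∀ {Γ Γ′ Γ″} →
    Pointwise _≈ₜ_ Γ Γ′ → Pointwise _≈ₜ_ Γ′ Γ″ → Pointwise _≈ₜ_ Γ Γ″
  ≈*-trans []       []       = []
  ≈*-trans (p ∷ ps) (q ∷ qs) = ≈ₜ-trans p q ∷ ≈*-trans ps qs

  ≈-trans : ∀ {Θ Θ′ Θ″} → Θ ≈ Θ′ → Θ′ ≈ Θ″ → Θ ≈ Θ″
  ≈-trans (p ⨾ q) (p′ ⨾ q′) = ↭-trans p p′ ⨾ ≈*-trans q q′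

≈-reflexive : Θ ≡ Θ′ → Θ ≈ Θ′
≈-reflexive ≡.refl = ≈-refl

infix 4 _⨾≡_

_⨾≡_ : ζ ↭ ζ′ → Γ ≡ Γ′ → (ζ ⨾ Γ) ≈ (ζ′ ⨾ Γ′)
p ⨾≡ ≡.refl = p ⨾ ≈*-refl

⟪⟫-cong : ∀ Ξ → Θ ≈ Θ′ → Ξ ⟪ Θ ⟫ ≈ Ξ ⟪ Θ′ ⟫
⟪⟫-cong hole             p = p
⟪⟫-cong (inside ζ Γ Ξ Δ) p =
  ↭-refl ⨾ Pointwise.++⁺ ≈*-refl (⟦ ⟪⟫-cong Ξ p ⟧ ∷ ≈*-refl)

-- The monoid of meta-formulae and its one-hole contexts.

infixr 5 _⊗_

_⊗_ : Meta → Meta → Meta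
(ζ ⨾ Γ) ⊗ (ξ ⨾ Δ) = ζ ++ ξ ⨾ Γ ++ Δ

ε : Meta
ε = [] ⨾ []

⟨_⟩ᶠ : Formula → Meta
⟨ A ⟩ᶠ = [] ⨾ [ fm A ]

⟨_⟩ᵇ : Meta → Meta
⟨ Θ ⟩ᵇ = [] ⨾ [ ⟦ Θ ⟧ ]

⊗-assoc : ∀ x y z → (x ⊗ y) ⊗ z ≡ x ⊗ (y ⊗ z)
⊗-assoc (ζ₁ ⨾ Γ₁) (ζ₂ ⨾ Γ₂) (ζ₃ ⨾ Γ₃) =
  ≡.cong₂ _⨾_ (++-assoc ζ₁ ζ₂ ζ₃) (++-assoc Γ₁ Γ₂ Γ₃)

⊗-identityˡ : ∀ x → ε ⊗ x ≡ x
⊗-identityˡ (ζ ⨾ Γ) = ≡.refl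

⊗-identityʳ : ∀ x → x ⊗ ε ≡ x
⊗-identityʳ (ζ ⨾ Γ) = ≡.cong₂ _⨾_ (++-identityʳ ζ) (++-identityʳ Γ)

⊗-cong : x ≈ x′ → y ≈ y′ → x ⊗ y ≈ x′ ⊗ y′
⊗-cong (p ⨾ q) (p′ ⨾ q′) = ++⁺ p p′ ⨾ Pointwise.++⁺ q q′

⟨⟩ᵇ-cong : x ≈ y → ⟨ x ⟩ᵇ ≈ ⟨ y ⟩ᵇ
⟨⟩ᵇ-cong p = ↭-refl ⨾ (⟦ p ⟧ ∷ [])

-- Contexts Ξ ⟪ ξ , ζ ⨾ Γ₁ , · , Γ₂ ⟫ presented as functions, so that composition
-- and application compute.
data Ctx : (Meta → Meta) → Set where
  id      : Ctx (λ x → x)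
  left    : ∀ y → Ctx f → Ctx (λ x → y ⊗ f x)
  right   : ∀ y → Ctx f → Ctx (λ x → f x ⊗ y)
  bracket : Ctx f → Ctx (λ x → ⟨ f x ⟩ᵇ)

compose : Ctx f → Ctx g → Ctx (f ∘ g)
compose id          d = d
compose (left y c)  d = left y (compose c d)
compose (right y c) d = right y (compose c d)
compose (bracket c) d = bracket (compose c d)

Ctx-cong : Ctx f → x ≈ x′ → f x ≈ f x′
Ctx-cong id          p = p
Ctx-cong (left y c)  p = ⊗-cong ≈-refl (Ctx-cong c p)
Ctx-cong (right y c) p = ⊗-cong (Ctx-cong c p) ≈-refl
Ctx-cong (bracket c) p = ⟨⟩ᵇ-cong (Ctx-cong c p)

-- Bridges the two notions of context: a `Ctx` may have its hole in the middle of a sequence,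
-- whereas the hole of a `Context` is all of a bracket's content, so the neighbours of the hole are
-- recorded separately.
record NormalForm (f : Meta → Meta) : Set where
  constructor nf
  field
    around       : Context
    stoup        : Stoup
    before after : List TreeTerm
    decompose    : ∀ ξ Π → f (ξ ⨾ Π) ≈ around ⟪ ξ ++ stoup ⨾ before ++ Π ++ after ⟫

-- A factor added by `left` or `right` joins the neighbours of the hole as long as no bracket
-- encloses it; after that it joins the outermost layer of `around`.
normalise : Ctx f → NormalForm f
normalise id = nf hole [] [] [] λ ξ Π →
  ≈-reflexive (≡.sym (⊗-identityʳ (ξ ⨾ Π)))
normalise (left (η ⨾ Δ) c) with normalise c
... | nf hole ζ Γ₁ Γ₂ eq = nf hole (η ++ ζ) (Δ ++ Γ₁) Γ₂ λ ξ Π →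
  ≈-trans (⊗-cong ≈-refl (eq ξ Π))
    (solve 3 (λ η ξ ζ → η ⊕ (ξ ⊕ ζ) ⊜ ξ ⊕ (η ⊕ ζ)) ↭-refl η ξ ζ
      ⨾≡ ≡.sym (++-assoc Δ Γ₁ (Π ++ Γ₂)))
... | nf (inside θ Θ₁ Ξ Θ₂) ζ Γ₁ Γ₂ eq = nf (inside (η ++ θ) (Δ ++ Θ₁) Ξ Θ₂) ζ Γ₁ Γ₂ λ ξ Π →
  ≈-trans (⊗-cong ≈-refl (eq ξ Π)) (↭-refl ⨾≡ ≡.sym (++-assoc Δ Θ₁ _))
normalise (right (η ⨾ Δ) c) with normalise c
... | nf hole ζ Γ₁ Γ₂ eq = nf hole (ζ ++ η) Γ₁ (Γ₂ ++ Δ) λ ξ Π →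
  ≈-trans (⊗-cong (eq ξ Π) ≈-refl)
    (↭-reflexive (++-assoc ξ ζ η)
      ⨾≡ ≡.trans (++-assoc Γ₁ (Π ++ Γ₂) Δ) (≡.cong (Γ₁ ++_) (++-assoc Π Γ₂ Δ)))
... | nf (inside θ Θ₁ Ξ Θ₂) ζ Γ₁ Γ₂ eq = nf (inside (θ ++ η) Θ₁ Ξ (Θ₂ ++ Δ)) ζ Γ₁ Γ₂ λ ξ Π →
  ≈-trans (⊗-cong (eq ξ Π) ≈-refl) (↭-refl ⨾≡ ++-assoc Θ₁ _ Δ)
normalise (bracket c) with normalise c
... | nf Ξ ζ Γ₁ Γ₂ eq = nf (inside [] [] Ξ []) ζ Γ₁ Γ₂ λ ξ Π → ⟨⟩ᵇ-cong (eq ξ Π)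

-- Covers, and the left rules as covers.

infix 3 _◁_

-- The closure operator of the phase model: `x` passes every test, given by a context `f` and a
-- succedent `C`, that all elements of `P` pass.
_◁_ : Meta → (Meta → Set) → Set
x ◁ P = ∀ {f} → Ctx f → ∀ C → (∀ y → P y → f y ⊢ C) → f x ⊢ C

｛_｝ : Meta → Meta → Set
｛ x ｝ y = x ≡ y

-- Here and in the following lemmas, `normalise` brings an arbitrary test into the shape that the
-- left rule expects, and `resp` carries derivability across the decomposition.
/L◁ : ∀ {x} → x ⊢ B → ⟨ C / B ⟩ᶠ ⊗ x ◁ ｛ ⟨ C ⟩ᶠ ｝
/L◁ {x = ζ₁ ⨾ Γ} d c D k with nf Ξ ζ Γ₁ Γ₂ eq ← normalise c =
  resp (≈-sym (eq _ _)) (/L Ξ d (resp (eq _ _) (k _ ≡.refl)))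

⧵L◁ : ∀ {x} → x ⊢ A → x ⊗ ⟨ A ⧵ C ⟩ᶠ ◁ ｛ ⟨ C ⟩ᶠ ｝
⧵L◁ {x = ζ₁ ⨾ Γ} d c D k with nf Ξ ζ Γ₁ Γ₂ eq ← normalise c =
  resp (≈-sym (≈-trans (eq _ _)
         (⟪⟫-cong Ξ (++⁺ʳ ζ (↭-reflexive (++-identityʳ ζ₁))
                     ⨾≡ ≡.cong (Γ₁ ++_) (++-assoc Γ _ Γ₂)))))
       (⧵L Ξ d (resp (eq _ _) (k _ ≡.refl)))

·L◁ : ⟨ A · B ⟩ᶠ ◁ ｛ ⟨ A ⟩ᶠ ⊗ ⟨ B ⟩ᶠ ｝
·L◁ c D k with nf Ξ ζ Γ₁ Γ₂ eq ← normalise c =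
  resp (≈-sym (eq _ _)) (·L Ξ (resp (eq _ _) (k _ ≡.refl)))

𝟏L◁ : ⟨ 𝟏 ⟩ᶠ ◁ ｛ ε ｝
𝟏L◁ c D k with nf Ξ ζ Γ₁ Γ₂ eq ← normalise c =
  resp (≈-sym (eq _ _)) (𝟏L Ξ (resp (eq _ _) (k _ ≡.refl)))

∨L◁ : ⟨ A ∨ B ⟩ᶠ ◁ (λ y → ｛ ⟨ A ⟩ᶠ ｝ y ⊎ ｛ ⟨ B ⟩ᶠ ｝ y)
∨L◁ c D k with nf Ξ ζ Γ₁ Γ₂ eq ← normalise c =
  resp (≈-sym (eq _ _))
    (∨L Ξ (resp (eq _ _) (k _ (inj₁ ≡.refl))) (resp (eq _ _) (k _ (inj₂ ≡.refl))))

∧L₁◁ : ⟨ A ∧ B ⟩ᶠ ◁ ｛ ⟨ A ⟩ᶠ ｝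
∧L₁◁ c D k with nf Ξ ζ Γ₁ Γ₂ eq ← normalise c =
  resp (≈-sym (eq _ _)) (∧L₁ Ξ (resp (eq _ _) (k _ ≡.refl)))

∧L₂◁ : ⟨ A ∧ B ⟩ᶠ ◁ ｛ ⟨ B ⟩ᶠ ｝
∧L₂◁ c D k with nf Ξ ζ Γ₁ Γ₂ eq ← normalise c =
  resp (≈-sym (eq _ _)) (∧L₂ Ξ (resp (eq _ _) (k _ ≡.refl)))

[]⁻¹L◁ : ⟨ ⟨ []⁻¹ A ⟩ᶠ ⟩ᵇ ◁ ｛ ⟨ A ⟩ᶠ ｝
[]⁻¹L◁ c D k with nf Ξ ζ Γ₁ Γ₂ eq ← normalise c =
  resp (≈-sym (eq _ _)) ([]⁻¹L Ξ (resp (eq _ _) (k _ ≡.refl)))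

⟨⟩L◁ : ⟨ ⟨⟩ A ⟩ᶠ ◁ ｛ ⟨ ⟨ A ⟩ᶠ ⟩ᵇ ｝
⟨⟩L◁ c D k with nf Ξ ζ Γ₁ Γ₂ eq ← normalise c =
  resp (≈-sym (eq _ _)) (⟨⟩L Ξ (resp (eq _ _) (k _ ≡.refl)))

!L◁ : ⟨ ! A ⟩ᶠ ◁ ｛ [ A ] ⨾ [] ｝
!L◁ {A} c D k with nf Ξ ζ Γ₁ Γ₂ eq ← normalise c =
  resp (≈-sym (eq _ _))
    (!L Ξ (resp (≈-trans (eq _ _) (⟪⟫-cong Ξ (++-comm [ A ] ζ ⨾≡ ≡.refl))) (k _ ≡.refl)))

!P◁ : [ A ] ⨾ [] ◁ ｛ ⟨ A ⟩ᶠ ｝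
!P◁ {A} c D k with nf Ξ ζ Γ₁ Γ₂ eq ← normalise c =
  resp (≈-sym (≈-trans (eq _ _) (⟪⟫-cong Ξ (++-comm [ A ] ζ ⨾≡ ≡.refl))))
    (!P Ξ (resp (eq _ _) (k _ ≡.refl)))

-- Here `x` holds the remaining content of the contracted bracket; `ζ₁`, `Γ₁` and `Γ₃` of the rule
-- are supplied by the test.
!C′◁ : ξ ≢ [] → (ξ ⨾ []) ⊗ x ◁ ｛ (ξ ⨾ []) ⊗ ⟨ x ⊗ (ξ ⨾ []) ⟩ᵇ ｝
!C′◁ {ξ} {ζ′ ⨾ Γ} ξ≢[] c D k with nf Ξ ζ Γ₁ Γ₂ eq ← normalise c =
  resp (≈-sym (≈-trans (eq _ _) (⟪⟫-cong Ξ
         (++-comm (ξ ++ ζ′) ζ ⨾≡ ≡.refl))))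
    (!C′ Ξ ξ≢[] (resp (≈-trans (eq _ _) (⟪⟫-cong Ξ
         (↭-trans (++⁺ʳ ζ (↭-reflexive (++-identityʳ ξ))) (++-comm ξ ζ)
          ⨾ Pointwise.++⁺ ≈*-refl (⟦ ↭-refl ⨾≡ ++-identityʳ Γ ⟧ ∷ ≈*-refl))))
      (k _ ≡.refl)))

-- The interpretation of formulae.

-- The positive connectives are closures of their generators; the others inherit closedness from
-- their components. The generators for `! A` are non-empty stoups with no tree terms, which is the
-- shape of the premise of `!R′`.
𝓥 : Formula → Meta → Set
𝓥 (var p) x = x ⊢ var p
𝓥 𝟏       x = x ◁ ｛ ε ｝
𝓥 (A ⧵ C) x = ∀ y → 𝓥 A y → 𝓥 C (y ⊗ x)
𝓥 (C / B) x = ∀ y → 𝓥 B y → 𝓥 C (x ⊗ y)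
𝓥 (A · B) x = x ◁ λ z → ∃₂ λ y w → 𝓥 A y × 𝓥 B w × z ≡ y ⊗ w
𝓥 (A ∧ B) x = 𝓥 A x × 𝓥 B x
𝓥 (A ∨ B) x = x ◁ λ y → 𝓥 A y ⊎ 𝓥 B y
𝓥 (⟨⟩ A)  x = x ◁ λ z → ∃[ y ] 𝓥 A y × z ≡ ⟨ y ⟩ᵇ
𝓥 ([]⁻¹ A) x = 𝓥 A ⟨ x ⟩ᵇ
𝓥 (! A)   x = x ◁ λ z → ∃[ ξ ] ξ ≢ [] × 𝓥 A (ξ ⨾ []) × z ≡ (ξ ⨾ [])

◁-join : ∀ {P} → x ◁ (_◁ P) → x ◁ P
◁-join h c C k = h c C λ y y◁P → y◁P c C k

-- A test of `f x` is a test of `x` once the two contexts are composed.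
◁-ctx : ∀ {P Q} → Ctx f → x ◁ P → (∀ y → P y → Q (f y)) → f x ◁ Q
◁-ctx d h g c C k = h (compose c d) C λ y Py → k _ (g y Py)

-- For the implications and `[]⁻¹`, membership means that `x` placed in a certain context lies in
-- the interpretation of a subformula, so `◁-ctx` reduces to that subformula.
closed : ∀ A → x ◁ 𝓥 A → 𝓥 A x
closed (var p)  h = h id (var p) λ y d → d
closed 𝟏        h = ◁-join h
closed (A ⧵ C)  h = λ y Vy → closed C (◁-ctx (left y id) h λ z Vz → Vz y Vy)
closed (C / B)  h = λ y Vy → closed C (◁-ctx (right y id) h λ z Vz → Vz y Vy)
closed (A · B)  h = ◁-join h
closed (A ∧ B)  h = closed A (◁-ctx id h λ { y (Vy , _) → Vy })
                  , closed B (◁-ctx id h λ { y (_ , Vy) → Vy })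
closed (A ∨ B)  h = ◁-join h
closed (⟨⟩ A)   h = ◁-join h
closed ([]⁻¹ A) h = closed A (◁-ctx (bracket id) h λ y Vy → Vy)
closed (! A)    h = ◁-join h

𝓥-step : ∀ {P} → x ◁ P → (∀ y → P y → 𝓥 A y) → 𝓥 A x
𝓥-step {A = A} h g = closed A (◁-ctx id h g)

≈⇒◁ : x ≈ x′ → x′ ◁ ｛ x ｝
≈⇒◁ p c C k = resp (Ctx-cong c p) (k _ ≡.refl)

𝓥-resp : ∀ A → x ≈ x′ → 𝓥 A x → 𝓥 A x′
𝓥-resp A p Vx = 𝓥-step {A = A} (≈⇒◁ p) λ { _ ≡.refl → Vx }

∈⇒◁ : ∀ {P : Meta → Set} → P x → x ◁ P
∈⇒◁ Px c C k = k _ Px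

mutual
  -- Simultaneous induction with `reify`: left rules serve `reflect`, right rules serve `reify`, and
  -- an implication needs the other direction for its argument.
  reflect : ∀ A → 𝓥 A ⟨ A ⟩ᶠ
  reflect (var p)  = ax
  reflect 𝟏        = 𝟏L◁
  reflect (A ⧵ C)  = λ y Vy → 𝓥-step {A = C} (⧵L◁ (reify A Vy)) λ { _ ≡.refl → reflect C }
  reflect (C / B)  = λ y Vy → 𝓥-step {A = C} (/L◁ (reify B Vy)) λ { _ ≡.refl → reflect C }
  reflect (A · B)  = ◁-ctx id ·L◁ λ { _ ≡.refl → _ , _ , reflect A , reflect B , ≡.refl }
  reflect (A ∧ B)  = 𝓥-step {A = A} ∧L₁◁ (λ { _ ≡.refl → reflect A })
                   , 𝓥-step {A = B} ∧L₂◁ (λ { _ ≡.refl → reflect B })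
  reflect (A ∨ B)  = ◁-ctx id ∨L◁ λ { _ (inj₁ ≡.refl) → inj₁ (reflect A)
                                    ; _ (inj₂ ≡.refl) → inj₂ (reflect B) }
  reflect (⟨⟩ A)   = ◁-ctx id ⟨⟩L◁ λ { _ ≡.refl → _ , reflect A , ≡.refl }
  reflect ([]⁻¹ A) = 𝓥-step {A = A} []⁻¹L◁ λ { _ ≡.refl → reflect A }
  reflect (! A)    = ◁-ctx id !L◁ λ { _ ≡.refl → _ , (λ ()) , reflectˢ A , ≡.refl }

  reflectˢ : ∀ A → 𝓥 A ([ A ] ⨾ [])
  reflectˢ A = 𝓥-step {A = A} !P◁ λ { _ ≡.refl → reflect A }

  reify : ∀ {x} A → 𝓥 A x → x ⊢ A
  reify (var p) d = d
  reify 𝟏       h = h id 𝟏 λ { _ ≡.refl → 𝟏R }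
  reify {ζ ⨾ Γ} (A ⧵ C) h = ⧵R (reify C (h _ (reflect A)))
  reify {ζ ⨾ Γ} (C / B) h =
    /R (resp (↭-reflexive (++-identityʳ ζ) ⨾≡ ≡.refl) (reify C (h _ (reflect B))))
  reify (A · B)  h = h id (A · B) λ { _ ((_ ⨾ _) , (_ ⨾ _) , Vy , Vw , ≡.refl) →
                                       ·R (reify A Vy) (reify B Vw) }
  reify (A ∧ B) (Vx , Wx) = ∧R (reify A Vx) (reify B Wx)
  reify (A ∨ B)  h = h id (A ∨ B) λ { _ (inj₁ Vy) → ∨R₁ (reify A Vy)
                                    ; _ (inj₂ Vy) → ∨R₂ (reify B Vy) }
  reify (⟨⟩ A)   h = h id (⟨⟩ A) λ { _ (_ , Vy , ≡.refl) → ⟨⟩R (reify A Vy) }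
  reify ([]⁻¹ A) h = []⁻¹R (reify A h)
  reify (! A)    h = h id (! A) λ { _ (_ , ξ≢[] , Vξ , ≡.refl) → !R′ ξ≢[] (reify A Vξ) }

-- Replacing formula occurrences by elements of their interpretations.

infix 3 _⇝ₜ_ _⇝ₗ_ _⇝ₛ_ _⇝_

mutual
  data _⇝ₜ_ : TreeTerm → Meta → Set where
    fm  : 𝓥 A x → fm A ⇝ₜ x
    ⟦_⟧ : Θ ⇝ x → ⟦ Θ ⟧ ⇝ₜ ⟨ x ⟩ᵇ

  data _⇝ₗ_ : List TreeTerm → Meta → Set where
    []  : [] ⇝ₗ ε
    _∷_ : T ⇝ₜ x → Γ ⇝ₗ y → T ∷ Γ ⇝ₗ x ⊗ y

  data _⇝ₛ_ : Stoup → Stoup → Set where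
    []   : [] ⇝ₛ []
    cons : ξ ≢ [] → 𝓥 A (ξ ⨾ []) → ζ ⇝ₛ ξ′ → A ∷ ζ ⇝ₛ ξ ++ ξ′

  data _⇝_ : Meta → Meta → Set where
    -- The image of a tree term may bring its own stoup, which merges with `ξ`; the final `≈`
    -- absorbs the order of the result.
    combine : ζ ⇝ₛ ξ → Γ ⇝ₗ x → (ξ ⨾ []) ⊗ x ≈ y → ζ ⨾ Γ ⇝ y

⇝ₛ-↭ : ζ ↭ ζ′ → ζ ⇝ₛ ξ → ∃[ ξ′ ] ζ′ ⇝ₛ ξ′ × ξ ↭ ξ′
⇝ₛ-↭ refl         r = _ , r , ↭-refl
⇝ₛ-↭ (prep _ p)   (cons {ξ = ξ} n v r) with _ , r′ , q ← ⇝ₛ-↭ p r = _ , cons n v r′ , ++⁺ˡ ξ q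
⇝ₛ-↭ (swap _ _ p) (cons {ξ = ξ₁} n v (cons {ξ = ξ₂} {ξ′ = ξ₃} m w r))
  with ξ₃′ , r′ , q ← ⇝ₛ-↭ p r = _ , cons m w (cons n v r′) ,
    ↭-trans (solve 3 (λ a b c → a ⊕ (b ⊕ c) ⊜ b ⊕ (a ⊕ c)) ↭-refl ξ₁ ξ₂ ξ₃)
            (++⁺ˡ ξ₂ (++⁺ˡ ξ₁ q))
⇝ₛ-↭ (trans p p′) r with _ , r′ , q ← ⇝ₛ-↭ p r with _ , r″ , q′ ← ⇝ₛ-↭ p′ r′ =
  _ , r″ , ↭-trans q q′

mutual
  ⇝ₜ-resp : ∀ {T T′} → T ≈ₜ T′ → T ⇝ₜ x → T′ ⇝ₜ x
  ⇝ₜ-resp (fm A) r     = r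
  ⇝ₜ-resp ⟦ p ⟧  ⟦ r ⟧ = ⟦ ⇝-respˡ p r ⟧

  ⇝ₗ-resp : Pointwise _≈ₜ_ Γ Γ′ → Γ ⇝ₗ x → Γ′ ⇝ₗ x
  ⇝ₗ-resp []       []       = []
  ⇝ₗ-resp (p ∷ ps) (r ∷ rs) = ⇝ₜ-resp p r ∷ ⇝ₗ-resp ps rs

  ⇝-respˡ : Θ ≈ Θ′ → Θ ⇝ x → Θ′ ⇝ x
  ⇝-respˡ (p ⨾ q) (combine s r e) with _ , s′ , p′ ← ⇝ₛ-↭ p s =
    combine s′ (⇝ₗ-resp q r) (≈-trans (⊗-cong (↭-sym p′ ⨾≡ ≡.refl) ≈-refl) e)

⇝ₛ-++⁺ : ζ ⇝ₛ ξ → ζ′ ⇝ₛ ξ′ → ζ ++ ζ′ ⇝ₛ ξ ++ ξ′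
⇝ₛ-++⁺ []           s′ = s′
⇝ₛ-++⁺ {ξ′ = ξ′} (cons {ξ = ξ₁} {ξ′ = ξ₂} n v s) s′ =
  ≡.subst (_ ⇝ₛ_) (≡.sym (++-assoc ξ₁ ξ₂ ξ′)) (cons n v (⇝ₛ-++⁺ s s′))

⇝ₛ-++⁻ : ∀ ζ → ζ ++ ζ′ ⇝ₛ ξ → ∃₂ λ ξ₁ ξ₂ → ζ ⇝ₛ ξ₁ × ζ′ ⇝ₛ ξ₂ × ξ₁ ++ ξ₂ ≡ ξ
⇝ₛ-++⁻ []      s = _ , _ , [] , s , ≡.refl
⇝ₛ-++⁻ (A ∷ ζ) (cons {ξ = ξ} n v s) with ξ₁ , ξ₂ , s₁ , s₂ , ≡.refl ← ⇝ₛ-++⁻ ζ s =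
  _ , _ , cons n v s₁ , s₂ , ++-assoc ξ ξ₁ ξ₂

⇝ₗ-++⁺ : Γ ⇝ₗ x → Δ ⇝ₗ y → Γ ++ Δ ⇝ₗ x ⊗ y
⇝ₗ-++⁺ {y = _ ⨾ _} []  r′ = r′
⇝ₗ-++⁺ {y = y} (_∷_ {x = x₁} {y = x₂} t r) r′ =
  ≡.subst (_ ⇝ₗ_) (≡.sym (⊗-assoc x₁ x₂ y)) (t ∷ ⇝ₗ-++⁺ r r′)

⇝ₗ-++⁻ : ∀ Γ → Γ ++ Δ ⇝ₗ x → ∃₂ λ y z → Γ ⇝ₗ y × Δ ⇝ₗ z × y ⊗ z ≡ x
⇝ₗ-++⁻ [] r = _ , _ , [] , r , ⊗-identityˡ _
⇝ₗ-++⁻ (T ∷ Γ) (_∷_ {x = x} t r) with y , z , r₁ , r₂ , ≡.refl ← ⇝ₗ-++⁻ Γ r =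
  _ , _ , t ∷ r₁ , r₂ , ⊗-assoc x y z

-- A factor without tree terms commutes with everything up to `≈`; this lets replacement be combined
-- and split along `⊗`.
stoup-interchange : ∀ ξ₁ ξ₂ x y →
  ((ξ₁ ⨾ []) ⊗ x) ⊗ ((ξ₂ ⨾ []) ⊗ y) ≈ (ξ₁ ++ ξ₂ ⨾ []) ⊗ (x ⊗ y)
stoup-interchange ξ₁ ξ₂ (ζ₁ ⨾ Γ₁) (ζ₂ ⨾ Γ₂) =
  solve 4 (λ a b c d → (a ⊕ c) ⊕ (b ⊕ d) ⊜ (a ⊕ b) ⊕ (c ⊕ d)) ↭-refl ξ₁ ξ₂ ζ₁ ζ₂ ⨾≡ ≡.refl

⇝-⊗⁺ : Θ ⇝ x → Θ′ ⇝ y → Θ ⊗ Θ′ ⇝ x ⊗ y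
⇝-⊗⁺ (combine {ξ = ξ₁} {x = x} s r e) (combine {ξ = ξ₂} {x = y} s′ r′ e′) =
  combine (⇝ₛ-++⁺ s s′) (⇝ₗ-++⁺ r r′)
    (≈-trans (≈-sym (stoup-interchange ξ₁ ξ₂ x y)) (⊗-cong e e′))

⇝-⊗⁻ : ∀ Θ → Θ ⊗ Θ′ ⇝ x → ∃₂ λ y z → Θ ⇝ y × Θ′ ⇝ z × y ⊗ z ≈ x
⇝-⊗⁻ {_ ⨾ _} (ζ ⨾ Γ) (combine s r e)
  with ξ₁ , ξ₂ , s₁ , s₂ , ≡.refl ← ⇝ₛ-++⁻ ζ s | y , z , r₁ , r₂ , ≡.refl ← ⇝ₗ-++⁻ Γ r =
  _ , _ , combine s₁ r₁ ≈-refl , combine s₂ r₂ ≈-refl ,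
    ≈-trans (stoup-interchange ξ₁ ξ₂ y z) e

ε⊗x⊗ε : ∀ x → ε ⊗ (x ⊗ ε) ≈ x
ε⊗x⊗ε (ζ ⨾ Γ) = ≈-reflexive (⊗-identityʳ (ζ ⨾ Γ))

⇝-fm⁺ : 𝓥 A x → ⟨ A ⟩ᶠ ⇝ x
⇝-fm⁺ v = combine [] (fm v ∷ []) (ε⊗x⊗ε _)

⇝-fm⁻ : ⟨ A ⟩ᶠ ⇝ x → 𝓥 A x
⇝-fm⁻ {A = A} (combine [] (fm v ∷ []) e) = 𝓥-resp A (≈-trans (≈-sym (ε⊗x⊗ε _)) e) v

⇝-bracket⁺ : Θ ⇝ x → ⟨ Θ ⟩ᵇ ⇝ ⟨ x ⟩ᵇ
⇝-bracket⁺ r = combine [] (⟦ r ⟧ ∷ []) ≈-refl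

⇝-bracket⁻ : ⟨ Θ ⟩ᵇ ⇝ x → ∃[ y ] Θ ⇝ y × ⟨ y ⟩ᵇ ≈ x
⇝-bracket⁻ (combine [] (⟦ r ⟧ ∷ []) e) = _ , r , e

⇝-ε : ε ⇝ ε
⇝-ε = combine [] [] ≈-refl

⇝-stoup⁺ : ζ ⇝ₛ ξ → ζ ⨾ [] ⇝ ξ ⨾ []
⇝-stoup⁺ s = combine s [] (≈-reflexive (⊗-identityʳ _))

⇝-stoup⁻ : ζ ⨾ [] ⇝ x → ∃[ ξ ] ζ ⇝ₛ ξ × (ξ ⨾ []) ≈ x
⇝-stoup⁻ (combine {ξ = ξ} s [] e) = ξ , s , ≈-trans (≈-reflexive (≡.sym (⊗-identityʳ _))) e

-- Transfers the provisos of `!R′` and `!C′` to images.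
⇝ₛ-nonempty : ζ ⇝ₛ ξ → ζ ≢ [] → ξ ≢ []
⇝ₛ-nonempty []                   n _  = n ≡.refl
⇝ₛ-nonempty (cons {ξ = ξ} n _ _) _ eq = n (++-conicalˡ ξ _ eq)

mutual
  ⇝ₗ-refl : ∀ Γ → Γ ⇝ₗ [] ⨾ Γ
  ⇝ₗ-refl []            = []
  ⇝ₗ-refl (fm A ∷ Γ)    = fm (reflect A) ∷ ⇝ₗ-refl Γ
  ⇝ₗ-refl (⟦ Θ ⟧ ∷ Γ)   = ⟦ ⇝-refl Θ ⟧ ∷ ⇝ₗ-refl Γ

  ⇝ₛ-refl : ∀ ζ → ζ ⇝ₛ ζ
  ⇝ₛ-refl []      = []
  ⇝ₛ-refl (A ∷ ζ) = cons {ξ = [ A ]} (λ ()) (reflectˢ A) (⇝ₛ-refl ζ)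

  ⇝-refl : ∀ Θ → Θ ⇝ Θ
  ⇝-refl (ζ ⨾ Γ) =
    combine (⇝ₛ-refl ζ) (⇝ₗ-refl Γ) (↭-reflexive (++-identityʳ ζ) ⨾≡ ≡.refl)

-- Soundness of the rules under replacement, and cut.

record Focus (Ξ : Context) (φ ζ : Stoup) (Γ₁ Π Γ₂ : List TreeTerm) (Ω : Meta) : Set where
  constructor focus
  field
    {plug} : Meta → Meta
    ctx    : Ctx plug
    {part} : Meta
    image  : φ ⨾ Π ⇝ part
    whole  : plug part ≈ Ω
    refill : ∀ {ψ Ψ y} → ψ ⨾ Ψ ⇝ y → Ξ ⟪ ψ ++ ζ ⨾ Γ₁ ++ Ψ ++ Γ₂ ⟫ ⇝ plug y

-- Separates the image of the active part `φ ⨾ Π` from that of its surroundings. The surroundings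
-- keep their image, so `refill` can put the active part of a premise, with any image of its own, in
-- the same place.
locate : ∀ Ξ φ ζ Γ₁ Π Γ₂ {Ω} → Ξ ⟪ φ ++ ζ ⨾ Γ₁ ++ Π ++ Γ₂ ⟫ ⇝ Ω → Focus Ξ φ ζ Γ₁ Π Γ₂ Ω
locate hole φ ζ Γ₁ Π Γ₂ r
  -- The level splits into three factors: `Γ₁` with an empty stoup, the active part, and `Γ₂` with
  -- the stoup `ζ`.
  with y , _ , r₁ , r′ , e  ← ⇝-⊗⁻ {φ ++ ζ ⨾ Π ++ Γ₂} ([] ⨾ Γ₁) r
  with _ , z , r₂ , r₃ , e′ ← ⇝-⊗⁻ {ζ ⨾ Γ₂} (φ ⨾ Π) r′ =
  focus (left y (right z id)) r₂ (≈-trans (⊗-cong ≈-refl e′) e)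
    λ r₂′ → ⇝-⊗⁺ r₁ (⇝-⊗⁺ r₂′ r₃)
locate (inside η Δ₁ Ξ Δ₂) φ ζ Γ₁ Π Γ₂ r
  with y , _ , r₁ , r′ , e  ← ⇝-⊗⁻ {η ⨾ ⟦ Ξ ⟪ _ ⟫ ⟧ ∷ Δ₂} ([] ⨾ Δ₁) r
  with _ , z , r₂ , r₃ , e′ ← ⇝-⊗⁻ {η ⨾ Δ₂} ⟨ Ξ ⟪ _ ⟫ ⟩ᵇ r′
  with _ , r₄ , e″ ← ⇝-bracket⁻ r₂
  with focus c image whole refill ← locate Ξ φ ζ Γ₁ Π Γ₂ r₄ =
  focus (left y (right z (bracket c))) image
    (≈-trans (⊗-cong ≈-refl (≈-trans (⊗-cong (≈-trans (⟨⟩ᵇ-cong whole) e″) ≈-refl) e′)) e)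
    λ r → ⇝-⊗⁺ r₁ (⇝-⊗⁺ (⇝-bracket⁺ (refill r)) r₃)

-- Since `𝓥 D` is closed, the image of a positive principal formula may be assumed to be a
-- generator.
𝓥-plug : ∀ D {P} → Ctx f → f x ≈ y → x ◁ P → (∀ z → P z → 𝓥 D (f z)) → 𝓥 D y
𝓥-plug D c e h g = 𝓥-resp D e (closed D (◁-ctx c h g))

sound : Θ ⊢ C → Θ ⇝ x → 𝓥 C x
sound (resp p d) r = sound d (⇝-respˡ (≈-sym p) r)
sound ax r = ⇝-fm⁻ r
sound 𝟏R (combine [] [] e) = ≈⇒◁ e
sound {C = D} (/L {ζ₁ = ζ₁} {Γ = Γ} {B} {ζ₂} {Δ₁} {C} {Δ₂} Ξ d d′) r
  with focus c i w k ← locate Ξ ζ₁ ζ₂ Δ₁ (fm (C / B) ∷ Γ) Δ₂ r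
  with _ , _ , r₁ , r₂ , e ← ⇝-⊗⁻ {ζ₁ ⨾ Γ} ⟨ C / B ⟩ᶠ i =
  -- The image of `C / B`, applied to that of `ζ₁ ⨾ Γ`, lies in `𝓥 C` and so may stand for `C` in
  -- the second premise.
  𝓥-resp D w (sound d′ (k (⇝-fm⁺ (𝓥-resp C e (⇝-fm⁻ r₁ _ (sound d r₂))))))
sound (/R {ζ = ζ} d) r y Vy =
  sound d (⇝-respˡ (↭-reflexive (++-identityʳ ζ) ⨾≡ ≡.refl) (⇝-⊗⁺ r (⇝-fm⁺ Vy)))
sound {C = D} (⧵L {ζ₁ = ζ₁} {Γ = Γ} {A} {ζ₂} {Δ₁} {C} {Δ₂} Ξ d d′) r
  with focus c i w k ← locate Ξ ζ₁ ζ₂ Δ₁ (Γ ++ [ fm (A ⧵ C) ]) Δ₂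
         (⇝-respˡ (⟪⟫-cong Ξ (↭-refl ⨾≡ ≡.cong (Δ₁ ++_) (≡.sym (++-assoc Γ _ Δ₂)))) r)
  with _ , _ , r₁ , r₂ , e ← ⇝-⊗⁻ {⟨ A ⧵ C ⟩ᶠ} (ζ₁ ⨾ Γ)
         (⇝-respˡ (↭-reflexive (≡.sym (++-identityʳ ζ₁)) ⨾≡ ≡.refl) i) =
  𝓥-resp D w (sound d′ (k (⇝-fm⁺ (𝓥-resp C e (⇝-fm⁻ r₂ _ (sound d r₁))))))
sound (⧵R {ζ = ζ} {A = A} {Γ} d) r y Vy = sound d (⇝-⊗⁺ {Θ′ = ζ ⨾ Γ} (⇝-fm⁺ Vy) r)
sound {C = D} (·L {ζ = ζ} {Δ₁} {A} {B} {Δ₂} Ξ d) r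
  with focus c i w k ← locate Ξ [] ζ Δ₁ [ fm (A · B) ] Δ₂ r =
  𝓥-plug D c w (⇝-fm⁻ i) λ { _ (_ , _ , Vy , Vz , ≡.refl) →
    sound d (k (⇝-⊗⁺ (⇝-fm⁺ Vy) (⇝-fm⁺ Vz))) }
sound {C = A · B} (·R {ζ₁ = ζ₁} {Δ} {ζ₂ = ζ₂} {Γ = Γ} d d′) r
  with _ , _ , r₁ , r₂ , e ← ⇝-⊗⁻ {ζ₂ ⨾ Γ} (ζ₁ ⨾ Δ) r =
  𝓥-resp (A · B) e (∈⇒◁ (_ , _ , sound d r₁ , sound d′ r₂ , ≡.refl))
sound {C = D} (𝟏L {ζ = ζ} {Δ₁} {Δ₂} Ξ d) r
  with focus c i w k ← locate Ξ [] ζ Δ₁ [ fm 𝟏 ] Δ₂ r =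
  𝓥-plug D c w (⇝-fm⁻ i) λ { _ ≡.refl → sound d (k ⇝-ε) }
sound {C = D} (∨L {ζ = ζ} {Δ₁} {A} {Δ₂} {A₂ = B} Ξ d d′) r
  with focus c i w k ← locate Ξ [] ζ Δ₁ [ fm (A ∨ B) ] Δ₂ r =
  𝓥-plug D c w (⇝-fm⁻ i) λ { _ (inj₁ Vy) → sound d (k (⇝-fm⁺ Vy))
                           ; _ (inj₂ Vy) → sound d′ (k (⇝-fm⁺ Vy)) }
sound (∨R₁ d) r = ∈⇒◁ (inj₁ (sound d r))
sound (∨R₂ d) r = ∈⇒◁ (inj₂ (sound d r))
sound {C = D} (∧L₁ {ζ = ζ} {Δ₁} {A} {Δ₂} {A₂ = B} Ξ d) r
  with focus c i w k ← locate Ξ [] ζ Δ₁ [ fm (A ∧ B) ] Δ₂ r with Vx , _ ← ⇝-fm⁻ {A ∧ B} i =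
  𝓥-resp D w (sound d (k (⇝-fm⁺ Vx)))
sound {C = D} (∧L₂ {ζ = ζ} {Δ₁} {B} {Δ₂} {A₁ = A} Ξ d) r
  with focus c i w k ← locate Ξ [] ζ Δ₁ [ fm (A ∧ B) ] Δ₂ r with _ , Vx ← ⇝-fm⁻ {A ∧ B} i =
  𝓥-resp D w (sound d (k (⇝-fm⁺ Vx)))
sound (∧R d d′) r = sound d r , sound d′ r
sound {C = D} ([]⁻¹L {ζ = ζ} {Δ₁} {A} {Δ₂} Ξ d) r
  with focus c i w k ← locate Ξ [] ζ Δ₁ [ ⟦ ⟨ []⁻¹ A ⟩ᶠ ⟧ ] Δ₂ r
  with _ , r′ , e ← ⇝-bracket⁻ i =
  𝓥-resp D w (sound d (k (⇝-fm⁺ (𝓥-resp A e (⇝-fm⁻ r′)))))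
sound ([]⁻¹R d) r = sound d (⇝-bracket⁺ r)
sound {C = D} (⟨⟩L {ζ = ζ} {Δ₁} {A} {Δ₂} Ξ d) r
  with focus c i w k ← locate Ξ [] ζ Δ₁ [ fm (⟨⟩ A) ] Δ₂ r =
  𝓥-plug D c w (⇝-fm⁻ i) λ { _ (_ , Vy , ≡.refl) → sound d (k (⇝-bracket⁺ (⇝-fm⁺ Vy))) }
sound {C = ⟨⟩ A} (⟨⟩R d) r with _ , r′ , e ← ⇝-bracket⁻ r =
  𝓥-resp (⟨⟩ A) e (∈⇒◁ (_ , sound d r′ , ≡.refl))
sound {C = D} (!L {ζ = ζ} {A} {Γ₁} {Γ₂} Ξ d) r
  with focus c i w k ← locate Ξ [] ζ Γ₁ [ fm (! A) ] Γ₂ r =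
  𝓥-plug D c w (⇝-fm⁻ i) λ { _ (ξ , n , Vξ , ≡.refl) →
    sound d (⇝-respˡ (⟪⟫-cong Ξ (++-comm [ A ] ζ ⨾≡ ≡.refl))
      -- A generator of `𝓥 (! A)` is exactly an admissible image of `A` in a stoup.
      (k (⇝-stoup⁺ (≡.subst (_ ⇝ₛ_) (++-identityʳ ξ) (cons n Vξ []))))) }
sound {C = D} (!P {ζ = ζ} {Γ₁} {A} {Γ₂} Ξ d) r
  with focus c i w k ← locate Ξ [ A ] ζ Γ₁ [] Γ₂
         (⇝-respˡ (⟪⟫-cong Ξ (++-comm ζ [ A ] ⨾≡ ≡.refl)) r)
  with _ , cons {ξ = ξ} n Vξ [] , e ← ⇝-stoup⁻ i =
  𝓥-resp D w (sound d (k (⇝-fm⁺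
    (𝓥-resp A (≈-trans (↭-reflexive (≡.sym (++-identityʳ ξ)) ⨾≡ ≡.refl) e) Vξ))))
sound {C = ! B} (!R′ n d) r with ξ , s , e ← ⇝-stoup⁻ r =
  𝓥-resp (! B) e (∈⇒◁ (ξ , ⇝ₛ-nonempty s n , sound d (⇝-stoup⁺ s) , ≡.refl))
sound {C = D} (!C′ {ζ₂ = ζ₂} {ζ₁} {Γ₁} {ζ′} {Γ₂} {Γ₃} Ξ n d) r
  with focus c i w k ← locate Ξ (ζ₂ ++ ζ′) ζ₁ Γ₁ Γ₂ Γ₃
         (⇝-respˡ (⟪⟫-cong Ξ (++-comm ζ₁ (ζ₂ ++ ζ′) ⨾≡ ≡.refl)) r)
  with _ , z , r₁ , r₂ , e ← ⇝-⊗⁻ {ζ′ ⨾ Γ₂} (ζ₂ ⨾ []) i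
  with ξ , s , e′ ← ⇝-stoup⁻ r₁ =
  -- Both copies of `ζ₂` in the premise receive the same image `ξ`, so `!C′◁` can contract them.
  𝓥-plug D c (≈-trans (Ctx-cong c (≈-trans (⊗-cong e′ ≈-refl) e)) w)
    (!C′◁ {x = z} (⇝ₛ-nonempty s n)) λ { _ ≡.refl →
      sound d (⇝-respˡ
        (⟪⟫-cong Ξ (↭-trans (++⁺ʳ ζ₁ (↭-reflexive (++-identityʳ ζ₂))) (++-comm ζ₂ ζ₁)
          ⨾ Pointwise.++⁺ ≈*-refl (⟦ ↭-refl ⨾≡ ++-identityʳ Γ₂ ⟧ ∷ ≈*-refl)))
        (k (⇝-⊗⁺ (⇝-stoup⁺ s) (⇝-bracket⁺ (⇝-⊗⁺ r₂ (⇝-stoup⁺ s)))))) }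

-- The cut formula receives `ξ ⨾ Π` as its image, while `⇝-refl` leaves the surrounding material
-- unchanged.
substitute : ∀ Ξ → 𝓥 A (ξ ⨾ Π) →
  Ξ ⟪ ζ ⨾ Γ ++ fm A ∷ Δ ⟫ ⇝ Ξ ⟪ ξ ++ ζ ⨾ Γ ++ Π ++ Δ ⟫
substitute {ξ = ξ} {Π} {ζ} {Γ} {Δ} hole v =
  ⇝-⊗⁺ (⇝-refl ([] ⨾ Γ)) (⇝-⊗⁺ (⇝-fm⁺ v) (⇝-refl (ζ ⨾ Δ)))
substitute (inside η Δ₁ Ξ Δ₂) v =
  ⇝-⊗⁺ (⇝-refl ([] ⨾ Δ₁)) (⇝-⊗⁺ (⇝-bracket⁺ (substitute Ξ v)) (⇝-refl (η ⨾ Δ₂)))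

theorem2 : (ξ ζ : Stoup) (Π Γ₁ Γ₂ : List TreeTerm) (A C : Formula) (Ξ : Context) →
    ξ ⨾ Π ⊢ A →
    Ξ ⟪ ζ ⨾ Γ₁ ++ fm A ∷ Γ₂ ⟫ ⊢ C →
    Ξ ⟪ ξ ++ ζ ⨾ Γ₁ ++ Π ++ Γ₂ ⟫ ⊢ C
theorem2 ξ ζ Π Γ₁ Γ₂ A C Ξ d e =
  reify C (sound e (substitute Ξ (sound d (⇝-refl (ξ ⨾ Π)))))
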